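{- Let $R,S$ be selections and let $\mathit{sk}$ be an annotated sketch. 1. If the annotations are sound, then $\mathit{sp}(R,\mathit{sk})\preceq_a S$ implies $\models_a\langle R\rangle\,\mathit{sk}\,\langle S\rangle$. 2. If the annotations are sound and complete, then $\models_a\langle R\rangle\,\mathit{sk}\,\langle S\rangle$ implies $\mathit{sp}(R,\mathit{sk})\preceq_a S$.
   Context: **Parameters and predicates.** Fix a set $\mathrm{States}$, a set $\mathrm{COM}$ of commands, and functions $[\![c]\!]:\mathrm{States}\to\mathrm{Predicates}$, where $\mathrm{Predicates}=\mathcal P(\mathrm{States})\cup\{\mathit{fail}\}$. $r\preceq_d s$ iff $s=\mathit{fail}$, or ($r\neq\mathit{fail}$ and $r\subseteq s$). The join $\sqcup_d$ of a set of predicates is $\mathit{fail}$ if $\mathit{fail}$ is a member, otherwise the union. Lift: $[\![c]\!](\mathit{fail})=\mathit{fail}$ and $[\![c]\!](r)=\bigsqcup_d\{[\![c]\!](q)\mid q\in r\}$ for $r\ne\mathit{fail}$. **Programs, sketches, validity.** Programs: $p::=c\mid p;p\mid p+p\mid p^*$. $\mathit{exec}(p)$ is the language of $p$ as a regular expression over $\mathrm{COM}$; $[\![e_1;e_2]\!](r)=[\![e_2]\!]([\![e_1]\!](r))$, the empty sequence is the identity. $\models_d\{r\}p\{s\}$ iff $[\![e]\!](r)\preceq_d s$ for all $e\in\mathit{exec}(p)$. Sketches additionally allow non-terminals $N$ from a finite set, each with a nonempty set of sketches as productions; $\mathit{drv}(\mathit{sk})$ is the set of programs derivable from $\mathit{sk}$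 by repeatedly replacing occurrences of non-terminals by productions (different occurrences may be replaced differently; $\mathit{sk}^*$ derives the $p^*$ with $p\in\mathit{drv}(\mathit{sk})$). A selection is a finite set of predicates. $R\preceq_a S$ iff $\forall s\in S\,\exists r\in R.\ r\preceq_d s$. $\models_a\langle R\rangle\mathit{sk}\langle S\rangle$ iff $\forall s\in S\,\exists r\in R\,\exists p\in\mathit{drv}(\mathit{sk}).\ \models_d\{r\}p\{s\}$. **Annotations.** In an annotated sketch every loop carries a selection $I$ (invariant), written $\mathit{sk}^*[I]$, and every non-terminal carries a map $\Gamma$ from selections to selections, written $N[\Gamma]$. Annotations are ignored in $\models_a$ and $\mathit{drv}$. $I$ at $\mathit{sk}^*[I]$ is *sound* if $\models_a\langle\{i\}\rangle\mathit{sk}\langle\{i\}\rangle$ for all $i\in I$, and *complete* if $\models_a\langle\{j\}\rangle\mathit{sk}\langle\{j\}\rangle$ implies $j\in I$. $\Gamma$ at $N[\Gamma]$ is *sound* if $\models_a\langle R\rangle N\langle\Gamma(R)\rangle$ for all $R$, and *complete* if $\models_a\langle R\rangle N\langle S\rangle$ implies $\Gamma(R)\preceq_a S$. **Strongest post.** - $\mathit{sp}(R,c)=\{[\![c]\!](r)\mid r\in R\}$; - $\mathit{sp}(R,N[\Gamma])=\Gamma(R)$; - $\mathit{sp}(R,\mathit{sk}_1;\mathit{sk}_2)=\mathit{sp}(\mathit{sp}(R,\mathit{sk}_1),\mathit{sk}_2)$; - $\mathit{sp}(R,\mathit{sk}^*[I])=\{i\in I\mid R\preceq_a\{i\}\}$;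 - $\mathit{sp}(R,\mathit{sk}_1+\mathit{sk}_2)=\{s_1\sqcup_d s_2\mid r\in R,\ s_1\in\mathit{sp}(\{r\},\mathit{sk}_1),\ s_2\in\mathit{sp}(\{r\},\mathit{sk}_2)\}$. -}

module Defs where

open import Level using (0ℓ) renaming (suc to lsuc)
open import Axiom.ExcludedMiddle using (ExcludedMiddle)
open import Data.Fin.Base using (Fin)
open import Data.List.Base using (List; []; _∷_; [_]; _++_; map; filter; concatMap; cartesianProductWith)
open import Data.List.Relation.Unary.All using (All)
open import Data.List.Relation.Unary.Any using (Any)
import Data.List.Membership.Setoid as Membership
import Data.List.Relation.Binary.Subset.Setoid as Subset
import Data.List.Relation.Binary.Subset.Setoid.Properties as Subsetₚ
open import Data.Nat.Base using (ℕ)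
open import Data.Product.Base using (_×_; _,_; proj₁; ∃; ∃-syntax)
open import Function.Bundles using (Func)
open import Relation.Binary.Bundles using (Setoid)
open import Relation.Binary.Construct.Closure.ReflexiveTransitive using (Star)
import Relation.Binary.Construct.Add.Supremum.Equality as Supremum-Equality
import Relation.Binary.Construct.Add.Supremum.NonStrict as Supremum-NonStrict
import Relation.Binary.Construct.Interior.Symmetric as Interior
open import Relation.Binary.PropositionalEquality.Core using (_≡_)
open import Relation.Nullary.Construct.Add.Supremum using (_⁺) renaming (⊤⁺ to fail; [_] to set) public
open import Relation.Nullary.Decidable.Core using (yes; no)
open import Relation.Unary using (Pred; _⊆_; _∪_; ∅; ⋃; _≐_)
open import Relation.Unary.Relation.Binary.Equality using (≐-isEquivalence)

-- The powerset of States is Pred States 0ℓ, with extensional equality _≐_;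
-- `fail` is a new greatest element and `set P` is the predicate P ⊆ States.

Predicate : Set → Set₁
Predicate States = Pred States 0ℓ ⁺

-- Finite sets of predicates are lists, considered up to having the same
-- elements (_≋_ below).

Selection : Set → Set₁
Selection States = List (Predicate States)

module Order (States : Set) where

  open Supremum-NonStrict (_⊆_ {A = States} {ℓ₁ = 0ℓ} {ℓ₂ = 0ℓ}) public
    using () renaming (_≤⁺_ to infix 4 _≼d_)

  private
    module ≈ = Supremum-Equality (_≐_ {A = States} {ℓ₁ = 0ℓ} {ℓ₂ = 0ℓ})

  predicateSetoid : Setoid (lsuc 0ℓ) (lsuc 0ℓ)
  predicateSetoid = record
    { Carrier       = Predicate States
    ; _≈_           = ≈._≈⁺_
    ; isEquivalence = ≈.≈⁺-isEquivalence ≐-isEquivalence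
    }

  open Membership predicateSetoid public using (_∈_)

  _≋_ : Selection States → Selection States → Set₁
  _≋_ = Interior.SymInterior (Subset._⊆_ predicateSetoid)

  selectionSetoid : Setoid (lsuc 0ℓ) (lsuc 0ℓ)
  selectionSetoid = record
    { Carrier       = Selection States
    ; _≈_           = _≋_
    ; isEquivalence = Interior.isEquivalence
                        (λ {R} → Subsetₚ.⊆-refl predicateSetoid {R})
                        (λ {R} {S} {T} → Subsetₚ.⊆-trans predicateSetoid {R} {S} {T})
    }

  infix 4 _≼a_
  _≼a_ : Selection States → Selection States → Set₁
  R ≼a S = All (λ s → Any (λ r → r ≼d s) R) S

infixr 7 _⨾_
infixr 6 _⊕_
infix  8 _✶

data Program (COM : Set) : Set where
  cmd : COM → Program COM
  _⨾_ : Program COM → Program COM → Program COM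
  _⊕_ : Program COM → Program COM → Program COM
  _✶  : Program COM → Program COM

data Sketch (COM : Set) (n : ℕ) : Set where
  cmd : COM → Sketch COM n
  non : Fin n → Sketch COM n
  _⨾_ : Sketch COM n → Sketch COM n → Sketch COM n
  _⊕_ : Sketch COM n → Sketch COM n → Sketch COM n
  _✶  : Sketch COM n → Sketch COM n

-- Γ is a map on selections as sets: it must send lists with the same
-- elements to lists with the same elements, hence `Func`.

data AnnSketch (States COM : Set) (n : ℕ) : Set₁ where
  cmd    : COM → AnnSketch States COM n
  _[_]ᴺ  : Fin n → Func (Order.selectionSetoid States) (Order.selectionSetoid States) →
           AnnSketch States COM n
  _⨾_    : AnnSketch States COM n → AnnSketch States COM n → AnnSketch States COM n
  _⊕_    : AnnSketch States COM n → AnnSketch States COM n → AnnSketch States COM n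
  _✶[_]  : AnnSketch States COM n → Selection States → AnnSketch States COM n

erase : ∀ {States COM n} → AnnSketch States COM n → Sketch COM n
erase (cmd c)     = cmd c
erase (N [ Γ ]ᴺ)  = non N
erase (sk₁ ⨾ sk₂) = erase sk₁ ⨾ erase sk₂
erase (sk₁ ⊕ sk₂) = erase sk₁ ⊕ erase sk₂
erase (sk ✶[ I ]) = erase sk ✶

⌜_⌝ : ∀ {COM n} → Program COM → Sketch COM n
⌜ cmd c ⌝   = cmd c
⌜ p₁ ⨾ p₂ ⌝ = ⌜ p₁ ⌝ ⨾ ⌜ p₂ ⌝
⌜ p₁ ⊕ p₂ ⌝ = ⌜ p₁ ⌝ ⊕ ⌜ p₂ ⌝
⌜ p ✶ ⌝     = ⌜ p ⌝ ✶

data _∈exec_ {COM : Set} : List COM → Program COM → Set where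
  command : ∀ {c} → [ c ] ∈exec cmd c
  _then_  : ∀ {e₁ e₂ p₁ p₂} → e₁ ∈exec p₁ → e₂ ∈exec p₂ → (e₁ ++ e₂) ∈exec (p₁ ⨾ p₂)
  left    : ∀ {e p₁ p₂} → e ∈exec p₁ → e ∈exec (p₁ ⊕ p₂)
  right   : ∀ {e p₁ p₂} → e ∈exec p₂ → e ∈exec (p₁ ⊕ p₂)
  stop    : ∀ {p} → [] ∈exec (p ✶)
  _more_  : ∀ {e₁ e₂ p} → e₁ ∈exec p → e₂ ∈exec (p ✶) → (e₁ ++ e₂) ∈exec (p ✶)

-- Excluded middle makes the case distinction in the join and the filtering
-- of invariants in sp definable as functions.

module Logic
  (em : ExcludedMiddle (lsuc 0ℓ))
  {States COM : Set}
  (⟦_⟧ : COM → States → Predicate States)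
  {n : ℕ}
  (productions : Fin n → Pred (Sketch COM n) 0ℓ)
  where

  open Order States

  -- The value at `fail` is irrelevant: elements is only used in ⨆d when no
  -- member of the family is fail.

  elements : Predicate States → Pred States 0ℓ
  elements fail    = ∅
  elements (set P) = P

  -- Join of the set { f i ∣ i ∈ I }.

  ⨆d : {I : Set} → (I → Predicate States) → Predicate States
  ⨆d {I} f with em {∃[ i ] f i ≡ fail}
  ... | yes _ = fail
  ... | no  _ = set (⋃[ i ∶ I ] elements (f i))

  -- Join of the set {r , s}.

  infixr 6 _⊔d_
  _⊔d_ : Predicate States → Predicate States → Predicate States
  fail  ⊔d s     = fail
  set P ⊔d fail  = fail
  set P ⊔d set Q = set (P ∪ Q)

  ⟦_⟧↑ : COM → Predicate States → Predicate States
  ⟦ c ⟧↑ fail    = fail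
  ⟦ c ⟧↑ (set P) = ⨆d {∃ P} (λ q → ⟦ c ⟧ (proj₁ q))

  ⟦_⟧ʷ : List COM → Predicate States → Predicate States
  ⟦ [] ⟧ʷ    r = r
  ⟦ c ∷ e ⟧ʷ r = ⟦ e ⟧ʷ (⟦ c ⟧↑ r)

  ⊨d⟨_⟩_⟨_⟩ : Predicate States → Program COM → Predicate States → Set₁
  ⊨d⟨ r ⟩ p ⟨ s ⟩ = ∀ e → e ∈exec p → ⟦ e ⟧ʷ r ≼d s

  -- Replacement of a single occurrence of a non-terminal.

  infix 4 _⟶_
  data _⟶_ : Sketch COM n → Sketch COM n → Set where
    produce : ∀ {N sk} → productions N sk → non N ⟶ sk
    seqˡ    : ∀ {sk₁ sk₁′ sk₂} → sk₁ ⟶ sk₁′ → sk₁ ⨾ sk₂ ⟶ sk₁′ ⨾ sk₂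
    seqʳ    : ∀ {sk₁ sk₂ sk₂′} → sk₂ ⟶ sk₂′ → sk₁ ⨾ sk₂ ⟶ sk₁ ⨾ sk₂′
    choiceˡ : ∀ {sk₁ sk₁′ sk₂} → sk₁ ⟶ sk₁′ → sk₁ ⊕ sk₂ ⟶ sk₁′ ⊕ sk₂
    choiceʳ : ∀ {sk₁ sk₂ sk₂′} → sk₂ ⟶ sk₂′ → sk₁ ⊕ sk₂ ⟶ sk₁ ⊕ sk₂′
    loop    : ∀ {sk sk′} → sk ⟶ sk′ → sk ✶ ⟶ sk′ ✶

  drv : Sketch COM n → Pred (Program COM) 0ℓ
  drv sk p = Star _⟶_ sk ⌜ p ⌝

  ⊨a⟨_⟩_⟨_⟩ : Selection States → Sketch COM n → Selection States → Set₁
  ⊨a⟨ R ⟩ sk ⟨ S ⟩ = All (λ s → Any (λ r → ∃[ p ] drv sk p × ⊨d⟨ r ⟩ p ⟨ s ⟩) R) S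

  module _ (sk : Sketch COM n) (I : Selection States) where

    SoundInvariants : Set₁
    SoundInvariants = ∀ i → i ∈ I → ⊨a⟨ [ i ] ⟩ sk ⟨ [ i ] ⟩

    CompleteInvariants : Set₁
    CompleteInvariants = ∀ j → ⊨a⟨ [ j ] ⟩ sk ⟨ [ j ] ⟩ → j ∈ I

  module _ (N : Fin n) (Γ : Func selectionSetoid selectionSetoid) where

    open Func Γ using (to)

    SoundMap : Set₁
    SoundMap = ∀ R → ⊨a⟨ R ⟩ non N ⟨ to R ⟩

    CompleteMap : Set₁
    CompleteMap = ∀ R S → ⊨a⟨ R ⟩ non N ⟨ S ⟩ → to R ≼a S

  data Sound : AnnSketch States COM n → Set₁ where
    cmd  : ∀ {c} → Sound (cmd c)
    non  : ∀ {N Γ} → SoundMap N Γ → Sound (N [ Γ ]ᴺ)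
    _⨾_  : ∀ {sk₁ sk₂} → Sound sk₁ → Sound sk₂ → Sound (sk₁ ⨾ sk₂)
    _⊕_  : ∀ {sk₁ sk₂} → Sound sk₁ → Sound sk₂ → Sound (sk₁ ⊕ sk₂)
    loop : ∀ {sk I} → SoundInvariants (erase sk) I → Sound sk → Sound (sk ✶[ I ])

  data Complete : AnnSketch States COM n → Set₁ where
    cmd  : ∀ {c} → Complete (cmd c)
    non  : ∀ {N Γ} → CompleteMap N Γ → Complete (N [ Γ ]ᴺ)
    _⨾_  : ∀ {sk₁ sk₂} → Complete sk₁ → Complete sk₂ → Complete (sk₁ ⨾ sk₂)
    _⊕_  : ∀ {sk₁ sk₂} → Complete sk₁ → Complete sk₂ → Complete (sk₁ ⊕ sk₂)
    loop : ∀ {sk I} → CompleteInvariants (erase sk) I → Complete sk → Complete (sk ✶[ I ])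

  sp : Selection States → AnnSketch States COM n → Selection States
  sp R (cmd c)     = map ⟦ c ⟧↑ R
  sp R (N [ Γ ]ᴺ)  = Func.to Γ R
  sp R (sk₁ ⨾ sk₂) = sp (sp R sk₁) sk₂
  sp R (sk₁ ⊕ sk₂) = concatMap (λ r → cartesianProductWith _⊔d_ (sp [ r ] sk₁) (sp [ r ] sk₂)) R
  sp R (sk ✶[ I ]) = filter (λ i → em {R ≼a [ i ]}) I

{-# OPTIONS --safe #-}

-- By induction on the sketch, for one postcondition s at a time.  Soundness
-- composes the derived programs.  For completeness of sk₁ ⨾ sk₂ and sk ✶, the
-- intermediate predicate (resp. the invariant) is the strongest postcondition
-- of the derived program: the join of ⟦ e ⟧ʷ r over all its executions e.  It
-- works because ⟦ e ⟧ʷ is monotone and distributes over joins.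

module Submission where

open import Defs
open import Level using (0ℓ) renaming (suc to lsuc)
open import Axiom.ExcludedMiddle using (ExcludedMiddle)
open import Data.Fin.Base using (Fin)
open import Data.List.Base using ([]; _∷_; [_]; _++_)
open import Data.List.Membership.Propositional using (find; lose)
open import Data.List.Membership.Propositional.Properties using (∈-filter⁺; ∈-filter⁻)
open import Data.List.Properties using (++-assoc; ++-identityʳ)
open import Data.List.Relation.Unary.All as All using ([]; _∷_)
open import Data.List.Relation.Unary.Any as Any using (Any; here)
open import Data.List.Relation.Unary.Any.Properties
  using (map⁺; map⁻; concatMap⁺; concatMap⁻; cartesianProductWith⁺; cartesianProductWith⁻)
open import Data.Nat.Base using (ℕ)
open import Data.Product.Base using (_×_; _,_; proj₁; ∃₂; ∃-syntax)
open import Data.Sum.Base as Sum using (inj₁; inj₂)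
open import Function.Base using (_∘_)
open import Relation.Binary.Bundles using (Setoid)
open import Relation.Binary.Construct.Add.Supremum.NonStrict
  using (_≤⊤⁺; ≤⁺-trans; ≤⁺-reflexive) renaming ([_] to lift)
open import Relation.Binary.Construct.Closure.ReflexiveTransitive using (Star; ε; _◅_; _◅◅_; gmap)
open import Relation.Binary.PropositionalEquality.Core using (_≡_; refl; sym; subst)
open import Relation.Nullary.Decidable.Core using (yes; no)
open import Relation.Nullary.Negation.Core using (contradiction)
open import Relation.Unary using (Pred; Satisfiable)

-- `_more_` adds an iteration at the front only, whereas invariance of a loop's postcondition needs
-- one at the end; reassociating `_++_` carries it past the earlier iterations.
snoc-exec : ∀ {COM : Set} {p : Program COM} {e₁ e₂} →
            e₁ ∈exec (p ✶) → e₂ ∈exec p → (e₁ ++ e₂) ∈exec (p ✶)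
snoc-exec {p = p} {e₂ = e₂} stop x₂ = subst (_∈exec (p ✶)) (++-identityʳ e₂) (x₂ more stop)
snoc-exec {p = p} {e₂ = e₂} (_more_ {e} {e′} x xs) x₂ =
  subst (_∈exec (p ✶)) (sym (++-assoc e e′ e₂)) (x more snoc-exec xs x₂)

module OrderProperties (States : Set) where

  open Order States

  ≼d-trans : ∀ {r s t} → r ≼d s → s ≼d t → r ≼d t
  ≼d-trans = ≤⁺-trans _ λ P⊆Q Q⊆R {_} x → Q⊆R (P⊆Q x)

  ≼d-reflexive : ∀ {r s} → Setoid._≈_ predicateSetoid r s → r ≼d s
  ≼d-reflexive = ≤⁺-reflexive _ proj₁

  ≼d-refl : ∀ {r} → r ≼d r
  ≼d-refl = ≼d-reflexive (Setoid.refl predicateSetoid)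

module LogicProperties
  (em : ExcludedMiddle (lsuc 0ℓ))
  {States COM : Set}
  (⟦_⟧ : COM → States → Predicate States)
  {n : ℕ}
  (productions : Fin n → Pred (Sketch COM n) 0ℓ)
  where

  open Order States
  open OrderProperties States
  open Logic em ⟦_⟧ productions

  -- Joins of predicates.

  ⨆d-upper : ∀ {I : Set} (f : I → Predicate States) i → f i ≼d ⨆d f
  ⨆d-upper f i with em {∃[ j ] f j ≡ fail}
  ... | yes _ = _ ≤⊤⁺
  ... | no ¬∃fail with f i in eq
  ...   | fail  = contradiction (i , eq) ¬∃fail
  -- The union still mentions `f i` itself, so `Px` is carried back along `eq`.
  ...   | set P = lift λ {x} Px → i , subst (λ r → elements r x) (sym eq) Px

  elements-mono : ∀ {r Q x} → r ≼d set Q → elements r x → Q x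
  elements-mono (lift P⊆Q) = P⊆Q

  ⨆d-least : ∀ {I : Set} (f : I → Predicate States) {s} → (∀ i → f i ≼d s) → ⨆d f ≼d s
  ⨆d-least f {fail}  f≼s = _ ≤⊤⁺
  ⨆d-least f {set Q} f≼s with em {∃[ j ] f j ≡ fail}
  ... | yes (i , fi≡fail) = subst (_≼d set Q) fi≡fail (f≼s i)
  ... | no _              = lift λ (i , x∈fi) → elements-mono (f≼s i) x∈fi

  ⊔d-least : ∀ {r s t} → r ≼d t → s ≼d t → r ⊔d s ≼d t
  ⊔d-least {t = fail} _ _ = _ ≤⊤⁺
  ⊔d-least {set _} {set _} {set _} (lift P⊆T) (lift Q⊆T) = lift (Sum.[_,_] P⊆T Q⊆T)

  ⊔d-upperˡ : ∀ r s → r ≼d r ⊔d s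
  ⊔d-upperˡ fail    s       = _ ≤⊤⁺
  ⊔d-upperˡ (set _) fail    = _ ≤⊤⁺
  ⊔d-upperˡ (set _) (set _) = lift inj₁

  ⊔d-upperʳ : ∀ r s → s ≼d r ⊔d s
  ⊔d-upperʳ fail    s       = _ ≤⊤⁺
  ⊔d-upperʳ (set _) fail    = _ ≤⊤⁺
  ⊔d-upperʳ (set _) (set _) = lift inj₂

  -- Monotonicity and distributivity of the semantics.

  ⟦⟧↑-upper : ∀ c r {x} → elements r x → ⟦ c ⟧ x ≼d ⟦ c ⟧↑ r
  ⟦⟧↑-upper c (set P) Px = ⨆d-upper (⟦ c ⟧ ∘ proj₁) (_ , Px)

  ⟦⟧↑-mono : ∀ c {r s} → r ≼d s → ⟦ c ⟧↑ r ≼d ⟦ c ⟧↑ s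
  ⟦⟧↑-mono c {s = fail} _ = _ ≤⊤⁺
  ⟦⟧↑-mono c {s = set Q} (lift P⊆Q) =
    ⨆d-least _ λ (_ , Px) → ⟦⟧↑-upper c (set Q) (P⊆Q Px)

  -- A member `fail` of the family stays `fail` under the lift and so dominates; otherwise each
  -- state of the union already lies in some `f i`.
  ⟦⟧↑-⨆d : ∀ c {I : Set} (f : I → Predicate States) → ⟦ c ⟧↑ (⨆d f) ≼d ⨆d (⟦ c ⟧↑ ∘ f)
  ⟦⟧↑-⨆d c f with em {∃[ j ] f j ≡ fail}
  ... | yes (i , fi≡fail) = subst (λ r → ⟦ c ⟧↑ r ≼d ⨆d (⟦ c ⟧↑ ∘ f)) fi≡fail (⨆d-upper _ i)
  ... | no _ = ⨆d-least _ λ (_ , i , x∈fi) →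
    ≼d-trans (⟦⟧↑-upper c (f i) x∈fi) (⨆d-upper (⟦ c ⟧↑ ∘ f) i)

  ⟦⟧ʷ-mono : ∀ e {r s} → r ≼d s → ⟦ e ⟧ʷ r ≼d ⟦ e ⟧ʷ s
  ⟦⟧ʷ-mono []      r≼s = r≼s
  ⟦⟧ʷ-mono (c ∷ e) r≼s = ⟦⟧ʷ-mono e (⟦⟧↑-mono c r≼s)

  -- Distributivity over joins, phrased with an upper bound `s`: each command is pushed into the
  -- join, and the induction continues with the family `⟦ c ⟧↑ ∘ f`.
  ⟦⟧ʷ-⨆d-least : ∀ e {I : Set} (f : I → Predicate States) {s} →
                 (∀ i → ⟦ e ⟧ʷ (f i) ≼d s) → ⟦ e ⟧ʷ (⨆d f) ≼d s
  ⟦⟧ʷ-⨆d-least []      f f≼s = ⨆d-least f f≼s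
  ⟦⟧ʷ-⨆d-least (c ∷ e) f f≼s =
    ≼d-trans (⟦⟧ʷ-mono e (⟦⟧↑-⨆d c f)) (⟦⟧ʷ-⨆d-least e (⟦ c ⟧↑ ∘ f) f≼s)

  ⟦⟧ʷ-++ : ∀ e₁ e₂ r → ⟦ e₁ ++ e₂ ⟧ʷ r ≡ ⟦ e₂ ⟧ʷ (⟦ e₁ ⟧ʷ r)
  ⟦⟧ʷ-++ []       e₂ r = refl
  ⟦⟧ʷ-++ (c ∷ e₁) e₂ r = ⟦⟧ʷ-++ e₁ e₂ (⟦ c ⟧↑ r)

  -- Validity of programs and strongest postconditions.

  ⊨d-conseq : ∀ {r r′ p s s′} → r ≼d r′ → s′ ≼d s → ⊨d⟨ r′ ⟩ p ⟨ s′ ⟩ → ⊨d⟨ r ⟩ p ⟨ s ⟩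
  ⊨d-conseq r≼r′ s′≼s v e x = ≼d-trans (⟦⟧ʷ-mono e r≼r′) (≼d-trans (v e x) s′≼s)

  ⊨d-seq : ∀ {r q s p₁ p₂} → ⊨d⟨ r ⟩ p₁ ⟨ q ⟩ → ⊨d⟨ q ⟩ p₂ ⟨ s ⟩ → ⊨d⟨ r ⟩ p₁ ⨾ p₂ ⟨ s ⟩
  ⊨d-seq {r} {s = s} v₁ v₂ _ (_then_ {e₁} {e₂} x₁ x₂) =
    subst (_≼d s) (sym (⟦⟧ʷ-++ e₁ e₂ r))
      (≼d-trans (⟦⟧ʷ-mono e₂ (v₁ e₁ x₁)) (v₂ e₂ x₂))

  ⊨d-choice : ∀ {r s p₁ p₂} → ⊨d⟨ r ⟩ p₁ ⟨ s ⟩ → ⊨d⟨ r ⟩ p₂ ⟨ s ⟩ → ⊨d⟨ r ⟩ p₁ ⊕ p₂ ⟨ s ⟩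
  ⊨d-choice v₁ v₂ e (left x)  = v₁ e x
  ⊨d-choice v₁ v₂ e (right x) = v₂ e x

  ⊨d-loop : ∀ {i p} → ⊨d⟨ i ⟩ p ⟨ i ⟩ → ⊨d⟨ i ⟩ p ✶ ⟨ i ⟩
  ⊨d-loop v _ stop = ≼d-refl
  ⊨d-loop {i} v _ (_more_ {e₁} {e₂} x₁ x₂) =
    subst (_≼d i) (sym (⟦⟧ʷ-++ e₁ e₂ i))
      (≼d-trans (⟦⟧ʷ-mono e₂ (v e₁ x₁)) (⊨d-loop v e₂ x₂))

  post : Predicate States → Program COM → Predicate States
  post r p = ⨆d {∃[ e ] e ∈exec p} λ (e , _) → ⟦ e ⟧ʷ r

  ⊨d-post : ∀ {r p} → ⊨d⟨ r ⟩ p ⟨ post r p ⟩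
  ⊨d-post e x = ⨆d-upper _ (e , x)

  post-least : ∀ {r p s} → ⊨d⟨ r ⟩ p ⟨ s ⟩ → post r p ≼d s
  post-least v = ⨆d-least _ λ (e , x) → v e x

  -- By distributivity it suffices to run `e₂` after each single execution `e₁` of `p₁`, and
  -- `e₁ ++ e₂` is an execution of the sequence.
  ⊨d-post-seq : ∀ {r p₁ p₂ s} → ⊨d⟨ r ⟩ p₁ ⨾ p₂ ⟨ s ⟩ → ⊨d⟨ post r p₁ ⟩ p₂ ⟨ s ⟩
  ⊨d-post-seq {r} {s = s} v e₂ x₂ = ⟦⟧ʷ-⨆d-least e₂ _ λ (e₁ , x₁) →
    subst (_≼d s) (⟦⟧ʷ-++ e₁ e₂ r) (v (e₁ ++ e₂) (x₁ then x₂))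

  -- An execution of `p ✶` followed by one of `p` is again one of `p ✶`, so `post r (p ✶)` is valid
  -- after `p ✶ ⨾ p`.
  post-loop-invariant : ∀ {r p} → ⊨d⟨ post r (p ✶) ⟩ p ⟨ post r (p ✶) ⟩
  post-loop-invariant {r} {p} = ⊨d-post-seq {p₁ = p ✶}
    λ { _ (_then_ x₁ x₂) → ⊨d-post {r} {p ✶} _ (snoc-exec x₁ x₂) }

  pre≼post-loop : ∀ {r p} → r ≼d post r (p ✶)
  pre≼post-loop = ⨆d-upper _ ([] , stop)

  -- Derivations of compound sketches.

  drv-seq⁺ : ∀ {sk₁ sk₂ p₁ p₂} → drv sk₁ p₁ → drv sk₂ p₂ → drv (sk₁ ⨾ sk₂) (p₁ ⨾ p₂)
  drv-seq⁺ {sk₂ = sk₂} d₁ d₂ = gmap (_⨾ sk₂) seqˡ d₁ ◅◅ gmap (_ ⨾_) seqʳ d₂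

  drv-choice⁺ : ∀ {sk₁ sk₂ p₁ p₂} → drv sk₁ p₁ → drv sk₂ p₂ → drv (sk₁ ⊕ sk₂) (p₁ ⊕ p₂)
  drv-choice⁺ {sk₂ = sk₂} d₁ d₂ = gmap (_⊕ sk₂) choiceˡ d₁ ◅◅ gmap (_ ⊕_) choiceʳ d₂

  drv-loop⁺ : ∀ {sk p} → drv sk p → drv (sk ✶) (p ✶)
  drv-loop⁺ = gmap _✶ loop

  -- Inversion goes through arbitrary target sketches, since ⌜ p ⌝ is not a
  -- pattern that the indices of Star can be unified with.

  ⟶*-cmd⁻ : ∀ {c sk} → Star _⟶_ (cmd c) sk → sk ≡ cmd c
  ⟶*-cmd⁻ ε = refl

  -- Each step rewrites inside one component and keeps the head `_⨾_`, so the steps can be sorted by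
  -- component.
  ⟶*-seq⁻ : ∀ {sk₁ sk₂ sk} → Star _⟶_ (sk₁ ⨾ sk₂) sk →
            ∃₂ λ sk₁′ sk₂′ → sk ≡ sk₁′ ⨾ sk₂′ × Star _⟶_ sk₁ sk₁′ × Star _⟶_ sk₂ sk₂′
  ⟶*-seq⁻ ε = _ , _ , refl , ε , ε
  ⟶*-seq⁻ (seqˡ x ◅ xs) with _ , _ , refl , d₁ , d₂ ← ⟶*-seq⁻ xs = _ , _ , refl , x ◅ d₁ , d₂
  ⟶*-seq⁻ (seqʳ x ◅ xs) with _ , _ , refl , d₁ , d₂ ← ⟶*-seq⁻ xs = _ , _ , refl , d₁ , x ◅ d₂

  ⟶*-choice⁻ : ∀ {sk₁ sk₂ sk} → Star _⟶_ (sk₁ ⊕ sk₂) sk →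
               ∃₂ λ sk₁′ sk₂′ → sk ≡ sk₁′ ⊕ sk₂′ × Star _⟶_ sk₁ sk₁′ × Star _⟶_ sk₂ sk₂′
  ⟶*-choice⁻ ε = _ , _ , refl , ε , ε
  ⟶*-choice⁻ (choiceˡ x ◅ xs) with _ , _ , refl , d₁ , d₂ ← ⟶*-choice⁻ xs = _ , _ , refl , x ◅ d₁ , d₂
  ⟶*-choice⁻ (choiceʳ x ◅ xs) with _ , _ , refl , d₁ , d₂ ← ⟶*-choice⁻ xs = _ , _ , refl , d₁ , x ◅ d₂

  ⟶*-loop⁻ : ∀ {sk sk′} → Star _⟶_ (sk ✶) sk′ → ∃[ sk″ ] sk′ ≡ sk″ ✶ × Star _⟶_ sk sk″
  ⟶*-loop⁻ ε = _ , refl , ε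
  ⟶*-loop⁻ (loop x ◅ xs) with _ , refl , d ← ⟶*-loop⁻ xs = _ , refl , x ◅ d

  drv-cmd⁻ : ∀ {c} p → drv (cmd c) p → p ≡ cmd c
  drv-cmd⁻ p d with ⟶*-cmd⁻ d
  -- The equation fixes the head of `⌜ p ⌝`, which rules out every other constructor for `p`.
  drv-cmd⁻ (cmd _) _ | refl = refl

  drv-seq⁻ : ∀ {sk₁ sk₂} p → drv (sk₁ ⨾ sk₂) p →
             ∃₂ λ p₁ p₂ → p ≡ p₁ ⨾ p₂ × drv sk₁ p₁ × drv sk₂ p₂
  drv-seq⁻ p d with ⟶*-seq⁻ d
  drv-seq⁻ (p₁ ⨾ p₂) _ | _ , _ , refl , d₁ , d₂ = p₁ , p₂ , refl , d₁ , d₂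

  drv-choice⁻ : ∀ {sk₁ sk₂} p → drv (sk₁ ⊕ sk₂) p →
                ∃₂ λ p₁ p₂ → p ≡ p₁ ⊕ p₂ × drv sk₁ p₁ × drv sk₂ p₂
  drv-choice⁻ p d with ⟶*-choice⁻ d
  drv-choice⁻ (p₁ ⊕ p₂) _ | _ , _ , refl , d₁ , d₂ = p₁ , p₂ , refl , d₁ , d₂

  drv-loop⁻ : ∀ {sk} p → drv (sk ✶) p → ∃[ p′ ] p ≡ p′ ✶ × drv sk p′
  drv-loop⁻ p d with ⟶*-loop⁻ d
  drv-loop⁻ (p ✶) _ | _ , refl , d = p , refl , d

  -- Soundness and completeness of `sp`.

  Achieves : Sketch COM n → Predicate States → Predicate States → Set₁
  Achieves sk s r = ∃[ p ] drv sk p × ⊨d⟨ r ⟩ p ⟨ s ⟩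

  Achieves-conseq : ∀ {sk r r′ s s′} → r ≼d r′ → s′ ≼d s →
                    Achieves sk s′ r′ → Achieves sk s r
  Achieves-conseq r≼r′ s′≼s (p , d , v) = p , d , ⊨d-conseq r≼r′ s′≼s v

  sp-sound : ∀ {sk R s} → Sound sk → Any (_≼d s) (sp R sk) → Any (Achieves (erase sk) s) R
  sp-sound (cmd {c}) t = Any.map (λ v → cmd c , ε , λ { _ command → v }) (map⁻ t)
  sp-sound {R = R} (non Γ-sound) t with s′ , s′∈ΓR , s′≼s ← find t =
    Any.map (Achieves-conseq ≼d-refl s′≼s) (All.lookup (Γ-sound R) s′∈ΓR)
  sp-sound (_⨾_ {sk₁} S₁ S₂) t
    -- The argument runs backwards: the second sketch picks `q`, which then serves as the
    -- postcondition for the first.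
    with q , q∈sp , p₂ , d₂ , v₂ ← find (sp-sound S₂ t) =
    Any.map (λ (p₁ , d₁ , v₁) → p₁ ⨾ p₂ , drv-seq⁺ d₁ d₂ , ⊨d-seq v₁ v₂)
      (sp-sound {sk₁} S₁ (lose q∈sp ≼d-refl))
  sp-sound {R = R} (_⊕_ {sk₁} {sk₂} S₁ S₂) t = Any.map choice (concatMap⁻ _ {xs = R} t)
    where
    choice : ∀ {s r} → Any (_≼d s) _ → Achieves (erase sk₁ ⊕ erase sk₂) s r
    choice {r = r} u
      with u₁ , u₂ ← cartesianProductWith⁻ _⊔d_
             (λ {s₁} {s₂} s₁⊔s₂≼s → ≼d-trans (⊔d-upperˡ s₁ s₂) s₁⊔s₂≼s
                                  , ≼d-trans (⊔d-upperʳ s₁ s₂) s₁⊔s₂≼s)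
             (sp [ r ] sk₁) (sp [ r ] sk₂) u
      -- Both calls concern the singleton `[ r ]`, so the two branches share their precondition.
      with here (p₁ , d₁ , v₁) ← sp-sound {sk₁} S₁ u₁
         | here (p₂ , d₂ , v₂) ← sp-sound {sk₂} S₂ u₂
      = p₁ ⊕ p₂ , drv-choice⁺ d₁ d₂ , ⊨d-choice v₁ v₂
  sp-sound {R = R} (loop {I = I} I-sound _) t
    with i , i∈sp , i≼s ← find t
    with i∈I , R≼i ∷ [] ← ∈-filter⁻ (λ i → em {R ≼a [ i ]}) {xs = I} i∈sp
    -- `∈-filter⁻` yields propositional membership, which is weakened to membership up to
    -- extensional equality.
    with here (p , d , v) ∷ [] ← I-sound i (Any.map (Setoid.reflexive predicateSetoid) i∈I)
    = Any.map (λ r≼i → p ✶ , drv-loop⁺ d , ⊨d-conseq r≼i i≼s (⊨d-loop v)) R≼i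

  sp-complete : ∀ {sk R s} → Complete sk → Any (Achieves (erase sk) s) R → Any (_≼d s) (sp R sk)
  sp-complete {s = s} (cmd {c}) t = map⁺ (Any.map valid t)
    where
    valid : ∀ {r} → Achieves (cmd c) s r → ⟦ c ⟧↑ r ≼d s
    valid (p , d , v) with refl ← drv-cmd⁻ p d = v [ c ] command
  sp-complete {R = R} {s} (non Γ-complete) t = All.head (Γ-complete R [ s ] (t ∷ []))
  sp-complete (_⨾_ {sk₁} C₁ C₂) t
    with r , r∈R , p , d , v ← find t
    with p₁ , p₂ , refl , d₁ , d₂ ← drv-seq⁻ p d
    -- Some `q′` in `sp R sk₁` lies below `post r p₁`, from which `p₂` achieves `s`; by monotonicity
    -- it does so from `q′` too.
    = sp-complete C₂
        (Any.map (λ q′≼q → p₂ , d₂ , ⊨d-conseq q′≼q ≼d-refl (⊨d-post-seq {p₁ = p₁} v))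
          (sp-complete {sk₁} C₁ (lose r∈R (p₁ , d₁ , ⊨d-post))))
  sp-complete {s = s} (_⊕_ {sk₁} {sk₂} C₁ C₂) t = concatMap⁺ _ (Any.map choice t)
    where
    choice : ∀ {r} → Achieves (erase sk₁ ⊕ erase sk₂) s r → Any (_≼d s) _
    choice (p , d , v) with p₁ , p₂ , refl , d₁ , d₂ ← drv-choice⁻ p d =
      cartesianProductWith⁺ _⊔d_ ⊔d-least
        (sp-complete {sk₁} C₁ (here (p₁ , d₁ , λ e x → v e (left x))))
        (sp-complete {sk₂} C₂ (here (p₂ , d₂ , λ e x → v e (right x))))
  sp-complete {R = R} (loop {I = I} I-complete _) t
    with r , r∈R , p , d , v ← find t
    with p′ , refl , d′ ← drv-loop⁻ p d
    -- Completeness puts the invariant `post r (p′ ✶)` into `I` only up to extensional equality; `i`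
    -- is its representative in the list.
    with i , i∈I , j≈i ← find
           (I-complete (post r (p′ ✶)) (here (p′ , d′ , post-loop-invariant) ∷ []))
    -- `i` passes the filter since the empty execution puts `r` below it, and it lies below `s`
    -- since `post` is least.
    = lose
        (∈-filter⁺ (λ i → em {R ≼a [ i ]}) i∈I
          (lose r∈R (≼d-trans pre≼post-loop (≼d-reflexive j≈i)) ∷ []))
        (≼d-trans (≼d-reflexive (Setoid.sym predicateSetoid j≈i)) (post-least v))

theorem5p2 : (em : ExcludedMiddle (lsuc 0ℓ))
    (States COM : Set)
    (⟦_⟧ : COM → States → Predicate States)
    (n : ℕ)
    (productions : Fin n → Pred (Sketch COM n) 0ℓ)
    (nonempty : ∀ N → Satisfiable (productions N)) →
    let open Order States
        open Logic em ⟦_⟧ productions in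
    (R S : Selection States)
    (sk : AnnSketch States COM n) →
    (Sound sk → sp R sk ≼a S → ⊨a⟨ R ⟩ erase sk ⟨ S ⟩) ×
    (Sound sk → Complete sk → ⊨a⟨ R ⟩ erase sk ⟨ S ⟩ → sp R sk ≼a S)
theorem5p2 em States COM ⟦_⟧ n productions nonempty R S sk =
  (λ sound → All.map (sp-sound sound)) , (λ _ complete → All.map (sp-complete complete))
  where open LogicProperties em ⟦_⟧ productions
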